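{- Let $n\ge 2$. If $C$ is a sorting network on $n$ channels with depth $d$, then there is a co-saturated sorting network $N$ on $n$ channels with depth $d$.
   Context: A comparator network on $n$ channels is a finite sequence $C=L_1,\ldots,L_d$ of layers, where each layer is a non-empty set of pairs (comparators) $(i,j)$ with $1\le i<j\le n$, and any two distinct comparators in the same layer are disjoint as sets of channels; $d$ is its depth, and layer $k$ means $L_k$. Inputs are Boolean vectors $\vec x\in\{0,1\}^n$. The network acts by applying the layers in order: applying a layer interchanges the values on channels $i$ and $j$ for every comparator $(i,j)$ of the layer such that the current value on channel $i$ is larger than the one on channel $j$. $C$ is a sorting network if its output is sorted in non-decreasing order for every $\vec x\in\{0,1\}^n$. A channel is used in a layer if some comparator of that layer contains it, and unused otherwise (if $d=1$, every channel counts as unused in layer $d-1=0$). A sorting network of depth $d$ is in last layer normal form (llnf) if its last layer only contains comparators of the form $(i,i+1)$, and there is no $i$ such that channels $i$ and $i+1$ are both unused in the last layer. For such a network, a block is either a set $\{i,i+1\}$ where $(i,i+1)$ is a comparator of the last layer, or a set $\{i\}$ where channel $i$ is unused in the last layer; the blocks partition the channels into intervals, and two blocks are consecutive if their union is an interval. A sorting network of depth $d$ is co-saturated if: (i) it is in llnf; (ii) there are no two consecutive blocks both of which contain a channel that is unused in layer $d-1$; and (iii) if $(i,i+1)$ is a comparator in layer $d$ and channels $i$ and $i+1$ are both unused in layer $d-1$, then channels $i-1$ and $i+2$ (whenever they exist, i.e. lie in $\{1,\ldots,n\}$) are used in layer $d$. -}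

module Defs where

open import Data.Bool using (Bool; if_then_else_)
import Data.Bool.Base as Bool
import Data.Bool.Properties as Bool
open import Data.Fin using (Fin; toℕ; _<_; _≤_)
open import Data.Fin.Subset using (Subset; ⁅_⁆; _∪_; _∈_)
open import Data.List using (List; []; foldl)
open import Data.List.Relation.Unary.All using (All)
open import Data.List.Relation.Unary.AllPairs using (AllPairs)
import Data.List.Membership.Propositional as List
open import Data.Nat using (ℕ; suc; _∸_)
open import Data.Product using (_×_; _,_; proj₁; proj₂; ∃; ∃-syntax; Σ-syntax)
open import Data.Sum using (_⊎_)
open import Data.Vec using (Vec; []; _∷_; lookup; _[_]≔_)
open import Relation.Binary.PropositionalEquality using (_≡_; _≢_)
open import Relation.Nullary using (¬_; does)

private variable
  n d : ℕ

-- Channels 1, …, n are represented by Fin n, so channel i is the element with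
-- toℕ equal to i ∸ 1.

Pair : ℕ → Set
Pair n = Fin n × Fin n

_∈ₚ_ : Fin n → Pair n → Set
k ∈ₚ (i , j) = k ≡ i ⊎ k ≡ j

Disjoint : Pair n → Pair n → Set
Disjoint p q = ∀ k → ¬ (k ∈ₚ p × k ∈ₚ q)

-- A finite set of pairs is given by a list enumerating it; `disjoint` rules
-- out repetitions, since no pair is disjoint from itself.
record Layer (n : ℕ) : Set where
  field
    comparators : List (Pair n)
    nonEmpty    : comparators ≢ []
    ordered     : All (λ (i , j) → i < j) comparators
    disjoint    : AllPairs Disjoint comparators

open Layer public

Network : ℕ → ℕ → Set
Network n d = Vec (Layer n) d

compareExchange : Vec Bool n → Pair n → Vec Bool n
compareExchange x (i , j) =
  if does (lookup x j Bool.<? lookup x i)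
  then (x [ i ]≔ lookup x j) [ j ]≔ lookup x i
  else x

-- The enumeration order is irrelevant, as the comparators are disjoint.
applyLayer : Layer n → Vec Bool n → Vec Bool n
applyLayer L x = foldl compareExchange x (comparators L)

apply : Network n d → Vec Bool n → Vec Bool n
apply []      x = x
apply (L ∷ C) x = apply C (applyLayer L x)

Sorted : Vec Bool n → Set
Sorted {n} x = {i j : Fin n} → i ≤ j → lookup x i Bool.≤ lookup x j

IsSorting : Network n d → Set
IsSorting {n} C = (x : Vec Bool n) → Sorted (apply C x)

-- `p ∈ C at k`: p is a comparator of layer k of C. Layers are numbered
-- 1, …, d; any other k has no comparators, so that every channel is unused
-- in layer 0.
_∈_at_ : Pair n → Network n d → ℕ → Set
_∈_at_ {d = d} p C k =
  Σ[ t ∈ Fin d ] suc (toℕ t) ≡ k × p List.∈ comparators (lookup C t)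

Used : Network n d → ℕ → Fin n → Set
Used C k i = ∃[ p ] p ∈ C at k × i ∈ₚ p

Unused : Network n d → ℕ → Fin n → Set
Unused C k i = ¬ Used C k i

_IsNextAfter_ : Fin n → Fin n → Set
j IsNextAfter i = toℕ j ≡ suc (toℕ i)

record LLNF (C : Network n d) : Set where
  field
    adjacent : ∀ {i j} → (i , j) ∈ C at d → j IsNextAfter i
    noGap    : ∀ {i j} → j IsNextAfter i → ¬ (Unused C d i × Unused C d j)

data IsBlock (C : Network n d) : Subset n → Set where
  pair   : ∀ {i j} → j IsNextAfter i → (i , j) ∈ C at d → IsBlock C (⁅ i ⁆ ∪ ⁅ j ⁆)
  single : ∀ {i} → Unused C d i → IsBlock C ⁅ i ⁆

IsInterval : Subset n → Set
IsInterval S = ∀ {i j k} → i ≤ j → j ≤ k → i ∈ S → k ∈ S → j ∈ S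

-- A ≢ B is needed because the union of a block with itself is an interval.
Consecutive : Subset n → Subset n → Set
Consecutive A B = A ≢ B × IsInterval (A ∪ B)

ContainsUnused : Network n d → ℕ → Subset n → Set
ContainsUnused C k S = ∃[ i ] i ∈ S × Unused C k i

record CoSaturated (C : Network n d) : Set where
  field
    llnf   : LLNF C
    blocks : ∀ {A B} → IsBlock C A → IsBlock C B → Consecutive A B →
             ¬ (ContainsUnused C (d ∸ 1) A × ContainsUnused C (d ∸ 1) B)
    flanks : ∀ {i j} → j IsNextAfter i → (i , j) ∈ C at d →
             Unused C (d ∸ 1) i → Unused C (d ∸ 1) j →
             (∀ {h} → i IsNextAfter h → Used C d h) ×
             (∀ {k} → k IsNextAfter j → Used C d k)

{-# OPTIONS --safe #-}

-- A comparator (i,j) of the last layer with i + 1 < j never swaps: whether it swaps is unaffected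
-- by exchanging a 1 and a 0 of the input, hence by running the network on the input, but on the
-- sorted result nothing is ever swapped. So such comparators can be dropped, and comparators
-- (i,i+1) can be added freely to the last layer. When the last layer L is of this form and sorts s,
-- any inversion of s is a comparator of L; hence every pair a < b of channels unused in the
-- penultimate layer may be added to that layer, being either inactive or repeated in L. Once this
-- is exhausted at most one channel is unused there, which is more than co-saturation asks for.
module Submission where

open import Defs
open import Data.Bool using (Bool; true; false; _∧_; _∨_)
import Data.Bool.Base as Bool
open import Data.Bool.Properties using (∨-zeroʳ; ∧-zeroʳ; ∨-identityʳ)
open import Data.Empty using (⊥-elim)
open import Data.Fin using (Fin; zero; suc; toℕ; fromℕ; fromℕ<; inject₁)
import Data.Fin as Fin
open import Data.Fin.Properties
  using (toℕ-injective; toℕ-fromℕ; toℕ-fromℕ<; toℕ-inject₁; toℕ<n; <-cmp; <⇒≢)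
  renaming (_≟_ to _≟ᶠ_; _<?_ to _<ᶠ?_)
open import Data.Fin.Subset using (Subset; ⁅_⁆; _∪_; _∈_)
open import Data.Fin.Subset.Properties using (x∈⁅y⁆⇒x≡y; x∈p∪q⁻)
open import Data.List using (List; []; _∷_; foldl; filter; cartesianProduct; allFin)
  renaming (_∷ʳ_ to _∷ʳₗ_)
open import Data.List.Membership.Propositional using (find) renaming (_∈_ to _∈ₗ_)
open import Data.List.Membership.Propositional.Properties
  using (∈-filter⁺; ∈-cartesianProduct⁺; ∈-allFin)
open import Data.List.Properties using (foldl-∷ʳ)
open import Data.List.Relation.Unary.All as All using (All; []; _∷_)
import Data.List.Relation.Unary.All.Properties as All
open import Data.List.Relation.Unary.AllPairs using (AllPairs; []; _∷_)
import Data.List.Relation.Unary.AllPairs.Properties as AllPairs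
open import Data.List.Relation.Unary.Any as Any using (Any; here; there)
import Data.List.Relation.Unary.Any.Properties as Any
open import Data.Nat using (ℕ; zero; suc; _≤_; _<_; s≤s; z≤n; _≟_)
import Data.Nat.Properties as ℕ
open import Data.Product using (_×_; _,_; proj₁; proj₂; ∃; Σ-syntax)
open import Data.Sum as Sum using (_⊎_; inj₁; inj₂; [_,_]′)
open import Data.Vec using (Vec; []; _∷_; lookup; _[_]≔_; _∷ʳ_; replicate; initLast)
open import Data.Vec.Properties using (lookup∘update; lookup∘update′; lookup-replicate)
open import Data.Vec.Relation.Binary.Pointwise.Extensional using (ext; Pointwise-≡⇒≡)
open import Level using (0ℓ)
open import Function using (_∘_)
open import Relation.Binary using (tri<; tri≈; tri>)
open import Relation.Binary.PropositionalEquality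
  using (_≡_; _≢_; refl; sym; trans; cong; cong₂; subst; module ≡-Reasoning)
open import Relation.Nullary using (¬_; Dec; yes; no; contradiction)
open import Relation.Nullary.Decidable using (_⊎-dec_)
open import Relation.Unary using (Pred; Decidable)

private variable
  n m k : ℕ
  A : Set

Ordered Adjacent : Pair n → Set
Ordered (i , j) = i Fin.< j
Adjacent (i , j) = j IsNextAfter i

adjacent⇒ordered : {p : Pair n} → Adjacent p → Ordered p
adjacent⇒ordered eq = ℕ.≤-reflexive (sym eq)

_∈ₚ?_ : (k : Fin n) (p : Pair n) → Dec (k ∈ₚ p)
k ∈ₚ? (i , j) = (k ≟ᶠ i) ⊎-dec (k ≟ᶠ j)

run : List (Pair n) → Vec Bool n → Vec Bool n
run cs x = foldl compareExchange x cs

true≢false : {b : Bool} → b ≡ true → b ≢ false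
true≢false refl ()

lookup-ext : {x y : Vec A n} → (∀ k → lookup x k ≡ lookup y k) → x ≡ y
lookup-ext eq = Pointwise-≡⇒≡ (ext eq)

-- Comparators and layers, channel by channel

compareExchange-fst : (x : Vec Bool n) {i j : Fin n} → i ≢ j →
  lookup (compareExchange x (i , j)) i ≡ lookup x i ∧ lookup x j
compareExchange-fst x {i} {j} i≢j with lookup x i in eqᵢ | lookup x j in eqⱼ
... | true  | true  = eqᵢ
... | true  | false = trans (lookup∘update′ i≢j (x [ i ]≔ false) true) (lookup∘update i x false)
... | false | true  = eqᵢ
... | false | false = eqᵢ

compareExchange-snd : (x : Vec Bool n) (i j : Fin n) →
  lookup (compareExchange x (i , j)) j ≡ lookup x i ∨ lookup x j
compareExchange-snd x i j with lookup x i in eqᵢ | lookup x j in eqⱼ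
... | true  | true  = eqⱼ
... | true  | false = lookup∘update j (x [ i ]≔ false) true
... | false | true  = eqⱼ
... | false | false = eqⱼ

compareExchange-other : (x : Vec Bool n) (p : Pair n) {k : Fin n} → ¬ (k ∈ₚ p) →
  lookup (compareExchange x p) k ≡ lookup x k
compareExchange-other x (i , j) k∉p with lookup x i | lookup x j
... | true  | true  = refl
... | true  | false = trans (lookup∘update′ (k∉p ∘ inj₂) (x [ i ]≔ false) true)
                            (lookup∘update′ (k∉p ∘ inj₁) x false)
... | false | true  = refl
... | false | false = refl

compareExchange-≤ : (x : Vec Bool n) {i j : Fin n} → lookup x i Bool.≤ lookup x j →
  compareExchange x (i , j) ≡ x
compareExchange-≤ x {i} {j} le with lookup x i | lookup x j
... | true  | true  = refl
... | true  | false = contradiction le λ ()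
... | false | true  = refl
... | false | false = refl

compareExchange-∧ : (x : Vec Bool n) {i j : Fin n} → i ≢ j →
  let y = compareExchange x (i , j) in lookup y i ∧ lookup y j ≡ lookup x i ∧ lookup x j
compareExchange-∧ x {i} {j} i≢j
  rewrite compareExchange-fst x i≢j | compareExchange-snd x i j with lookup x i | lookup x j
... | true  | true  = refl
... | true  | false = refl
... | false | _     = refl

compareExchange-∨ : (x : Vec Bool n) {i j : Fin n} → i ≢ j →
  let y = compareExchange x (i , j) in lookup y i ∨ lookup y j ≡ lookup x i ∨ lookup x j
compareExchange-∨ x {i} {j} i≢j
  rewrite compareExchange-fst x i≢j | compareExchange-snd x i j with lookup x i | lookup x j
... | true  | true  = refl
... | true  | false = refl
... | false | _     = refl

run-other : (cs : List (Pair n)) (x : Vec Bool n) {k : Fin n} →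
  All (λ c → ¬ (k ∈ₚ c)) cs → lookup (run cs x) k ≡ lookup x k
run-other []       x []         = refl
run-other (c ∷ cs) x (k∉c ∷ k∉) = trans (run-other cs _ k∉) (compareExchange-other x c k∉c)

disjoint-∉ : {p : Pair n} {k : Fin n} {cs : List (Pair n)} → k ∈ₚ p →
  All (Disjoint p) cs → All (λ c → ¬ (k ∈ₚ c)) cs
disjoint-∉ {k = k} k∈p = All.map λ p#c k∈c → p#c k (k∈p , k∈c)

-- By disjointness the comparator `(i , j)` meets the original inputs on its two channels, and
-- nothing touches its outputs afterwards. A layer therefore takes minima and maxima simultaneously,
-- whatever the order of the list.
run-fst : {cs : List (Pair n)} → All Ordered cs → AllPairs Disjoint cs →
  (x : Vec Bool n) {i j : Fin n} → (i , j) ∈ₗ cs → lookup (run cs x) i ≡ lookup x i ∧ lookup x j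
run-fst {cs = _ ∷ cs} (o ∷ _) (p# ∷ _) x (here refl) =
  trans (run-other cs _ (disjoint-∉ (inj₁ refl) p#)) (compareExchange-fst x (<⇒≢ o))
run-fst {cs = c ∷ _} (_ ∷ os) (c# ∷ ds) x {i} {j} (there p∈) =
  trans (run-fst os ds (compareExchange x c) p∈)
        (cong₂ _∧_ (compareExchange-other x c λ i∈c → All.lookup c# p∈ i (i∈c , inj₁ refl))
                   (compareExchange-other x c λ j∈c → All.lookup c# p∈ j (j∈c , inj₂ refl)))

run-snd : {cs : List (Pair n)} → AllPairs Disjoint cs →
  (x : Vec Bool n) {i j : Fin n} → (i , j) ∈ₗ cs → lookup (run cs x) j ≡ lookup x i ∨ lookup x j
run-snd {cs = _ ∷ cs} (p# ∷ _) x (here refl) =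
  trans (run-other cs _ (disjoint-∉ (inj₂ refl) p#)) (compareExchange-snd x _ _)
run-snd {cs = c ∷ _} (c# ∷ ds) x {i} {j} (there p∈) =
  trans (run-snd ds (compareExchange x c) p∈)
        (cong₂ _∨_ (compareExchange-other x c λ i∈c → All.lookup c# p∈ i (i∈c , inj₁ refl))
                   (compareExchange-other x c λ j∈c → All.lookup c# p∈ j (j∈c , inj₂ refl)))

comparator-unique : {cs : List (Pair n)} → AllPairs Disjoint cs → {p q : Pair n} {k : Fin n} →
  p ∈ₗ cs → q ∈ₗ cs → k ∈ₚ p → k ∈ₚ q → p ≡ q
comparator-unique (d ∷ ds) (here refl) (here refl) k∈p k∈q = refl
comparator-unique (d ∷ ds) (here refl) (there q∈)  k∈p k∈q = ⊥-elim (All.lookup d q∈ _ (k∈p , k∈q))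
comparator-unique (d ∷ ds) (there p∈)  (here refl) k∈p k∈q = ⊥-elim (All.lookup d p∈ _ (k∈q , k∈p))
comparator-unique (d ∷ ds) (there p∈)  (there q∈)  k∈p k∈q = comparator-unique ds p∈ q∈ k∈p k∈q

data Position (cs : List (Pair n)) (k : Fin n) : Set where
  first  : ∀ {j} → (k , j) ∈ₗ cs → Position cs k
  second : ∀ {i} → (i , k) ∈ₗ cs → Position cs k
  absent : All (λ c → ¬ (k ∈ₚ c)) cs → Position cs k

position : (cs : List (Pair n)) (k : Fin n) → Position cs k
position [] k = absent []
position (c ∷ cs) k with k ∈ₚ? c
... | yes (inj₁ refl) = first (here refl)
... | yes (inj₂ refl) = second (here refl)
... | no k∉c with position cs k
...   | first p∈  = first (there p∈)
...   | second p∈ = second (there p∈)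
...   | absent k∉ = absent (k∉c ∷ k∉)

-- Each output of the layer is a conjunction, a disjunction or a copy of inputs. Exchanging along
-- `p` beforehand preserves the conjunction and the disjunction of its two channels, and every other
-- comparator of `cs` avoids these channels.
run-compareExchange : {cs : List (Pair n)} → All Ordered cs → AllPairs Disjoint cs →
  {p : Pair n} → p ∈ₗ cs → (x : Vec Bool n) → run cs (compareExchange x p) ≡ run cs x
run-compareExchange {cs = cs} os ds {p} p∈ x = lookup-ext pointwise
  where
  y = compareExchange x p

  apart : ∀ {q k} → q ∈ₗ cs → q ≢ p → k ∈ₚ q → lookup y k ≡ lookup x k
  apart q∈ q≢p k∈q = compareExchange-other x p λ k∈p → q≢p (comparator-unique ds q∈ p∈ k∈q k∈p)

  both : (f : Bool → Bool → Bool) → ∀ {i j} →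
    ((i , j) ≡ p → f (lookup y i) (lookup y j) ≡ f (lookup x i) (lookup x j)) →
    (i , j) ∈ₗ cs → f (lookup y i) (lookup y j) ≡ f (lookup x i) (lookup x j)
  both f {i} {j} same q∈ with i ≟ᶠ proj₁ p | j ≟ᶠ proj₂ p
  ... | yes refl | yes refl = same refl
  ... | no i≢    | _        = cong₂ f (apart q∈ (i≢ ∘ cong proj₁) (inj₁ refl))
                                      (apart q∈ (i≢ ∘ cong proj₁) (inj₂ refl))
  ... | _        | no j≢    = cong₂ f (apart q∈ (j≢ ∘ cong proj₂) (inj₁ refl))
                                      (apart q∈ (j≢ ∘ cong proj₂) (inj₂ refl))

  p≢ : proj₁ p ≢ proj₂ p
  p≢ = <⇒≢ (All.lookup os p∈)

  pointwise : ∀ k → lookup (run cs y) k ≡ lookup (run cs x) k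
  pointwise k with position cs k
  ... | first q∈  = trans (run-fst os ds y q∈)
                      (trans (both _∧_ (λ { refl → compareExchange-∧ x p≢ }) q∈)
                             (sym (run-fst os ds x q∈)))
  ... | second q∈ = trans (run-snd ds y q∈)
                      (trans (both _∨_ (λ { refl → compareExchange-∨ x p≢ }) q∈)
                             (sym (run-snd ds x q∈)))
  ... | absent k∉ = trans (run-other cs y k∉)
                      (trans (compareExchange-other x p (All.lookup k∉ p∈))
                             (sym (run-other cs x k∉)))

-- It is enough to compare values in the input `x`: by disjointness, the comparators run earlier do
-- not change the channels of a later one, so each dropped comparator would have found its two
-- values already in order.
run-filter : {R : Pred (Pair n) 0ℓ} (R? : Decidable R) {cs : List (Pair n)} → AllPairs Disjoint cs →
  (x : Vec Bool n) → All (λ (i , j) → ¬ R (i , j) → lookup x i Bool.≤ lookup x j) cs →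
  run (filter R? cs) x ≡ run cs x
run-filter R? []        x []       = refl
run-filter {R = R} R? {c ∷ cs} (c# ∷ ds) x (le ∷ les) with R? c
... | yes _ = run-filter R? ds (compareExchange x c) (All.zipWith step (c# , les))
  where
  step : ∀ {q} → Disjoint c q × (¬ R q → lookup x (proj₁ q) Bool.≤ lookup x (proj₂ q)) →
    ¬ R q → lookup (compareExchange x c) (proj₁ q) Bool.≤ lookup (compareExchange x c) (proj₂ q)
  step {i , j} (c#q , le) ¬Rq
    rewrite compareExchange-other x c {i} (λ i∈c → c#q i (i∈c , inj₁ refl))
          | compareExchange-other x c {j} (λ j∈c → c#q j (j∈c , inj₂ refl)) = le ¬Rq
... | no ¬Rc = trans (run-filter R? ds x les)
                     (cong (run cs) (sym (compareExchange-≤ x (le ¬Rc))))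

-- Sorted vectors

true-upward : (x : Vec Bool n) → Sorted x → {i j : Fin n} → i Fin.≤ j →
  lookup x i ≡ true → lookup x j ≡ true
true-upward x s {i} {j} i≤j eq with lookup x i | lookup x j | s i≤j | eq
... | true | true | _ | _ = refl

false-downward : (x : Vec Bool n) → Sorted x → {i j : Fin n} → i Fin.≤ j →
  lookup x j ≡ false → lookup x i ≡ false
false-downward x s {i} {j} i≤j eq with lookup x i | lookup x j | s i≤j | eq
... | false | false | _ | _ = refl

run-sorted : {cs : List (Pair n)} → All Ordered cs → (x : Vec Bool n) → Sorted x → run cs x ≡ x
run-sorted []                     x s = refl
run-sorted {cs = _ ∷ cs} (o ∷ os) x s =
  trans (cong (run cs) (compareExchange-≤ x (s (ℕ.<⇒≤ o)))) (run-sorted os x s)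

apply-sorted : (C : Network n m) (x : Vec Bool n) → Sorted x → apply C x ≡ x
apply-sorted []      x s = refl
apply-sorted (L ∷ C) x s = trans (cong (apply C) (run-sorted (ordered L) x s)) (apply-sorted C x s)

apply-∷ʳ : (C : Network n m) (L : Layer n) (x : Vec Bool n) →
  apply (C ∷ʳ L) x ≡ applyLayer L (apply C x)
apply-∷ʳ []      L x = refl
apply-∷ʳ (K ∷ C) L x = apply-∷ʳ C L (applyLayer K x)

-- The covering relation of the Boolean lattice

record _⋖_ (x y : Vec Bool n) : Set where
  constructor cover
  field
    raised  : Fin n
    isFalse : lookup x raised ≡ false
    isTrue  : lookup y raised ≡ true
    same    : ∀ k → k ≢ raised → lookup x k ≡ lookup y k

⋖-true : {x y : Vec Bool n} → x ⋖ y → {k : Fin n} → lookup x k ≡ true → lookup y k ≡ true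
⋖-true (cover c _ yc same) {k} xk with k ≟ᶠ c
... | yes refl = yc
... | no k≢c   = trans (sym (same k k≢c)) xk

⋖-false : {x y : Vec Bool n} → x ⋖ y → {k : Fin n} → lookup y k ≡ false → lookup x k ≡ false
⋖-false (cover c xc _ same) {k} yk with k ≟ᶠ c
... | yes refl = xc
... | no k≢c   = trans (same k k≢c) yk

⋖-once : {x y : Vec Bool n} → x ⋖ y → {p q : Fin n} → lookup x p ≡ false → lookup y p ≡ true →
  lookup x q ≡ false → lookup y q ≡ true → p ≡ q
⋖-once (cover c _ _ same) {p} {q} xp yp xq yq with p ≟ᶠ c | q ≟ᶠ c
... | yes refl | yes refl = refl
... | no p≢c   | _        = contradiction (trans (sym (same p p≢c)) xp) (true≢false yp)
... | _        | no q≢c   = contradiction (trans (sym (same q q≢c)) xq) (true≢false yq)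

-- A comparator is monotone and preserves the number of ones, so its outputs still differ by a
-- single raised channel, possibly a different one.
compareExchange-⋖ : {x y : Vec Bool n} {p : Pair n} → Ordered p → x ⋖ y →
  compareExchange x p ⋖ compareExchange y p
compareExchange-⋖ {x = x} {y} {i , j} i<j (cover c xc yc same) = cases (c ≟ᶠ i) (c ≟ᶠ j)
  where
  x′ = compareExchange x (i , j)
  y′ = compareExchange y (i , j)
  i≢j = <⇒≢ i<j

  x′ᵢ : ∀ {a b} → lookup x i ≡ a → lookup x j ≡ b → lookup x′ i ≡ a ∧ b
  x′ᵢ xi xj = trans (compareExchange-fst x i≢j) (cong₂ _∧_ xi xj)
  y′ᵢ : ∀ {a b} → lookup y i ≡ a → lookup y j ≡ b → lookup y′ i ≡ a ∧ b
  y′ᵢ yi yj = trans (compareExchange-fst y i≢j) (cong₂ _∧_ yi yj)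
  x′ⱼ : ∀ {a b} → lookup x i ≡ a → lookup x j ≡ b → lookup x′ j ≡ a ∨ b
  x′ⱼ xi xj = trans (compareExchange-snd x i j) (cong₂ _∨_ xi xj)
  y′ⱼ : ∀ {a b} → lookup y i ≡ a → lookup y j ≡ b → lookup y′ j ≡ a ∨ b
  y′ⱼ yi yj = trans (compareExchange-snd y i j) (cong₂ _∨_ yi yj)

  other : ∀ {k} → k ≢ c → ¬ (k ∈ₚ (i , j)) → lookup x′ k ≡ lookup y′ k
  other k≢c k∉ = trans (compareExchange-other x (i , j) k∉)
                   (trans (same _ k≢c) (sym (compareExchange-other y (i , j) k∉)))

  at-i : c ∈ₚ (i , j) → lookup x′ i ≡ false → lookup y′ i ≡ true → lookup x′ j ≡ lookup y′ j → x′ ⋖ y′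
  at-i c∈ xi yi eqⱼ = cover i xi yi rest
    where
    rest : ∀ k → k ≢ i → lookup x′ k ≡ lookup y′ k
    rest k k≢i with k ≟ᶠ j
    ... | yes refl = eqⱼ
    ... | no k≢j   = other (λ { refl → [ k≢i , k≢j ]′ c∈ }) [ k≢i , k≢j ]′

  at-j : c ∈ₚ (i , j) → lookup x′ j ≡ false → lookup y′ j ≡ true → lookup x′ i ≡ lookup y′ i → x′ ⋖ y′
  at-j c∈ xj yj eqᵢ = cover j xj yj rest
    where
    rest : ∀ k → k ≢ j → lookup x′ k ≡ lookup y′ k
    rest k k≢j with k ≟ᶠ i
    ... | yes refl = eqᵢ
    ... | no k≢i   = other (λ { refl → [ k≢i , k≢j ]′ c∈ }) [ k≢i , k≢j ]′

  cases : Dec (c ≡ i) → Dec (c ≡ j) → x′ ⋖ y′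
  -- When the raised channel belongs to the comparator, its partner decides where the extra 1 ends:
  -- on `j` if the partner holds 0, on `i` if it holds 1.
  cases (yes refl) _ = at (lookup x j) refl (sym (same j (i≢j ∘ sym)))
    where
    at : ∀ b → lookup x j ≡ b → lookup y j ≡ lookup x j → x′ ⋖ y′
    at false xj yj = at-j (inj₁ refl) (x′ⱼ xc xj) (y′ⱼ yc (trans yj xj))
                       (trans (x′ᵢ xc xj) (sym (y′ᵢ yc (trans yj xj))))
    at true  xj yj = at-i (inj₁ refl) (x′ᵢ xc xj) (y′ᵢ yc (trans yj xj))
                       (trans (x′ⱼ xc xj) (sym (y′ⱼ yc (trans yj xj))))
  cases (no _) (yes refl) = at (lookup x i) refl (sym (same i i≢j))
    where
    at : ∀ b → lookup x i ≡ b → lookup y i ≡ lookup x i → x′ ⋖ y′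
    at false xi yi = at-j (inj₂ refl) (x′ⱼ xi xc) (y′ⱼ (trans yi xi) yc)
                       (trans (x′ᵢ xi xc) (sym (y′ᵢ (trans yi xi) yc)))
    at true  xi yi = at-i (inj₂ refl) (x′ᵢ xi xc) (y′ᵢ (trans yi xi) yc)
                       (trans (x′ⱼ xi xc) (sym (y′ⱼ (trans yi xi) yc)))
  cases (no c≢i) (no c≢j) =
    cover c (trans (compareExchange-other x (i , j) c∉) xc) (trans (compareExchange-other y (i , j) c∉) yc) rest
    where
    c∉ = [ c≢i , c≢j ]′
    rest : ∀ k → k ≢ c → lookup x′ k ≡ lookup y′ k
    rest k k≢c with k ≟ᶠ i | k ≟ᶠ j
    ... | yes refl | _        = trans (x′ᵢ (same i k≢c) (same j (c≢j ∘ sym))) (sym (y′ᵢ refl refl))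
    ... | no _     | yes refl = trans (x′ⱼ (same i (c≢i ∘ sym)) (same j k≢c)) (sym (y′ⱼ refl refl))
    ... | no k≢i   | no k≢j   = other k≢c [ k≢i , k≢j ]′

run-⋖ : {cs : List (Pair n)} → All Ordered cs → {x y : Vec Bool n} → x ⋖ y → run cs x ⋖ run cs y
run-⋖ []       x⋖y = x⋖y
run-⋖ (o ∷ os) x⋖y = run-⋖ os (compareExchange-⋖ o x⋖y)

apply-⋖ : (C : Network n m) {x y : Vec Bool n} → x ⋖ y → apply C x ⋖ apply C y
apply-⋖ []      x⋖y = x⋖y
apply-⋖ (L ∷ C) x⋖y = apply-⋖ C (run-⋖ (ordered L) x⋖y)

-- Both vectors have one 1 fewer than `y`, and a sorted vector is determined by its number of ones.
-- Concretely, if the cleared channels differed, the vector cleared at the larger one would have a 0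
-- there and a 1 on the smaller one.
sorted-lower-unique : {x y z : Vec Bool n} → Sorted x → Sorted z → x ⋖ y → z ⋖ y →
  ∀ k → lookup x k ≡ lookup z k
sorted-lower-unique {x = x} {z = z} sx sz (cover c xc yc xy) (cover c′ zc′ yc′ zy) k with <-cmp c c′
... | tri< c<c′ c≢c′ _ =
  contradiction zc′ (true≢false (true-upward z sz (ℕ.<⇒≤ c<c′) (trans (zy c c≢c′) yc)))
... | tri> _ c≢c′ c′<c =
  contradiction xc (true≢false (true-upward x sx (ℕ.<⇒≤ c′<c) (trans (xy c′ (c≢c′ ∘ sym)) yc′)))
... | tri≈ _ refl _ with k ≟ᶠ c
...   | yes refl = trans xc (sym zc′)
...   | no k≢c   = trans (xy k k≢c) (sym (zy k k≢c))

-- Dually, if the raised channels differed, the vector raised at the smaller one would have a 1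
-- there and a 0 on the larger one.
sorted-upper-unique : {x y z : Vec Bool n} → Sorted x → Sorted z → y ⋖ x → y ⋖ z →
  ∀ k → lookup x k ≡ lookup z k
sorted-upper-unique {x = x} {z = z} sx sz (cover c yc xc yx) (cover c′ yc′ zc′ yz) k with <-cmp c c′
... | tri< c<c′ c≢c′ _ =
  contradiction (trans (sym (yx c′ (c≢c′ ∘ sym))) yc′) (true≢false (true-upward x sx (ℕ.<⇒≤ c<c′) xc))
... | tri> _ c≢c′ c′<c =
  contradiction (trans (sym (yz c c≢c′)) yc) (true≢false (true-upward z sz (ℕ.<⇒≤ c′<c) zc′))
... | tri≈ _ refl _ with k ≟ᶠ c
...   | yes refl = trans xc (sym zc′)
...   | no k≢c   = trans (sym (yx k k≢c)) (yz k k≢c)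

-- Non-adjacent comparators of the last layer are redundant

module _ (C : Network n m) (L : Layer n) (sorting : IsSorting (C ∷ʳ L))
         {i j k : Fin n} (ij∈L : (i , j) ∈ₗ comparators L) (i<k : i Fin.< k) (k<j : k Fin.< j) where

  private
    out : Vec Bool n → Vec Bool n
    out x = applyLayer L (apply C x)

    out-sorted : ∀ x → Sorted (out x)
    out-sorted x = subst Sorted (apply-∷ʳ C L x) (sorting x)

    out-⋖ : ∀ {x y} → x ⋖ y → out x ⋖ out y
    out-⋖ x⋖y = run-⋖ (ordered L) (apply-⋖ C x⋖y)

    out-fst : ∀ x {a b} → lookup (apply C x) i ≡ a → lookup (apply C x) j ≡ b → lookup (out x) i ≡ a ∧ b
    out-fst x eqᵢ eqⱼ = trans (run-fst (ordered L) (disjoint L) (apply C x) ij∈L) (cong₂ _∧_ eqᵢ eqⱼ)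

    out-snd : ∀ x {a b} → lookup (apply C x) i ≡ a → lookup (apply C x) j ≡ b → lookup (out x) j ≡ a ∨ b
    out-snd x eqᵢ eqⱼ = trans (run-snd (disjoint L) (apply C x) ij∈L) (cong₂ _∨_ eqᵢ eqⱼ)

    Swaps : Vec Bool n → Set
    Swaps x = lookup (apply C x) i ≡ true × lookup (apply C x) j ≡ false

    -- The sorted outputs for x and z coincide. If their channel k is 0, the output for y still has
    -- 0 on i and 1 on j, so the swap persists from x to y and then to z; if it is 1, go through w.
    swaps-exchange : ∀ {w x y z} → x ⋖ y → z ⋖ y → w ⋖ x → w ⋖ z → Swaps x → Swaps z
    swaps-exchange {w} {x} {y} {z} x⋖y z⋖y w⋖x w⋖z (xᵢ , xⱼ) with lookup (out x) k in outₖ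
    ... | false = zᵢ , zⱼ
      where
      yᵢ : lookup (apply C y) i ≡ true
      yᵢ = ⋖-true (apply-⋖ C x⋖y) xᵢ
      yⱼ : lookup (apply C y) j ≡ false
      yⱼ with lookup (apply C y) j in eq
      ... | false = refl
      -- A 1 on `j` would put a 1 on `i` in the sorted output for `y`, hence also on `k`; both
      -- channels would rise from the output for `x`, but a cover raises only one.
      ... | true  = contradiction
        (⋖-once (out-⋖ x⋖y) (out-fst x xᵢ xⱼ) (out-fst y yᵢ eq)
                outₖ (true-upward (out y) (out-sorted y) (ℕ.<⇒≤ i<k) (out-fst y yᵢ eq)))
        (<⇒≢ i<k)
      zⱼ : lookup (apply C z) j ≡ false
      zⱼ = ⋖-false (apply-⋖ C z⋖y) yⱼ
      zᵢ : lookup (apply C z) i ≡ true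
      zᵢ = begin
        lookup (apply C z) i          ≡⟨ sym (∨-identityʳ _) ⟩
        lookup (apply C z) i ∨ false  ≡⟨ sym (out-snd z refl zⱼ) ⟩
        lookup (out z) j              ≡⟨ sorted-lower-unique (out-sorted z) (out-sorted x) (out-⋖ z⋖y) (out-⋖ x⋖y) j ⟩
        lookup (out x) j              ≡⟨ out-snd x xᵢ xⱼ ⟩
        true                          ∎
        where open ≡-Reasoning
    ... | true = zᵢ , zⱼ
      where
      wⱼ : lookup (apply C w) j ≡ false
      wⱼ = ⋖-false (apply-⋖ C w⋖x) xⱼ
      wᵢ : lookup (apply C w) i ≡ true
      wᵢ with lookup (apply C w) i in eq
      ... | true  = refl
      -- Dually, the output for `w` would have 0 on `j`, hence on `k`, and both channels would rise
      -- to 1 in the output for `x`.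
      ... | false = contradiction
        (⋖-once (out-⋖ w⋖x) (false-downward (out w) (out-sorted w) (ℕ.<⇒≤ k<j) (out-snd w eq wⱼ)) outₖ
                (out-snd w eq wⱼ) (out-snd x xᵢ xⱼ))
        (<⇒≢ k<j)
      zᵢ : lookup (apply C z) i ≡ true
      zᵢ = ⋖-true (apply-⋖ C w⋖z) wᵢ
      zⱼ : lookup (apply C z) j ≡ false
      zⱼ = begin
        lookup (apply C z) j  ≡⟨ sym (out-fst z zᵢ refl) ⟩
        lookup (out z) i      ≡⟨ sorted-upper-unique (out-sorted z) (out-sorted x) (out-⋖ w⋖z) (out-⋖ w⋖x) i ⟩
        lookup (out x) i      ≡⟨ out-fst x xᵢ xⱼ ⟩
        false                 ∎
        where open ≡-Reasoning

    swaps-compareExchange : ∀ {x} {p : Pair n} → Ordered p → Swaps x → Swaps (compareExchange x p)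
    swaps-compareExchange {x} {a , b} a<b sw with lookup x a in xa | lookup x b in xb
    ... | true  | true  = sw
    ... | false | true  = sw
    ... | false | false = sw
    ... | true  | false = swaps-exchange x⋖y z⋖y w⋖x w⋖z sw
      where
      -- On channels `a` and `b`, `x` reads 1, 0 and the exchanged input `z` reads 0, 1. Their meet
      -- `w` and join `y` complete a square of covers.
      w = x [ a ]≔ false
      y = x [ b ]≔ true
      z = w [ b ]≔ true
      a≢b = <⇒≢ a<b
      x⋖y : x ⋖ y
      x⋖y = cover b xb (lookup∘update b x true) λ k k≢b → sym (lookup∘update′ k≢b x true)
      w⋖x : w ⋖ x
      w⋖x = cover a (lookup∘update a x false) xa λ k k≢a → lookup∘update′ k≢a x false
      w⋖z : w ⋖ z
      w⋖z = cover b (trans (lookup∘update′ (a≢b ∘ sym) x false) xb) (lookup∘update b w true)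
              λ k k≢b → sym (lookup∘update′ k≢b w true)
      z⋖y : z ⋖ y
      z⋖y = cover a (trans (lookup∘update′ a≢b w true) (lookup∘update a x false))
              (trans (lookup∘update′ a≢b x true) xa) rest
        where
        rest : ∀ k → k ≢ a → lookup z k ≡ lookup y k
        rest k k≢a with k ≟ᶠ b
        ... | yes refl = trans (lookup∘update b w true) (sym (lookup∘update b x true))
        ... | no k≢b   = trans (lookup∘update′ k≢b w true)
                           (trans (lookup∘update′ k≢a x false) (sym (lookup∘update′ k≢b x true)))

    swaps-run : ∀ {cs x} → All Ordered cs → Swaps x → Swaps (run cs x)
    swaps-run []       sw = sw
    swaps-run (o ∷ os) sw = swaps-run os (swaps-compareExchange o sw)

    swaps-apply : ∀ {l} (D : Network n l) {x} → Swaps x → Swaps (apply D x)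
    swaps-apply []      sw = sw
    swaps-apply (K ∷ D) sw = swaps-apply D (swaps-run (ordered K) sw)

    ¬swaps-sorted : ∀ x → Sorted x → ¬ Swaps x
    ¬swaps-sorted x s (xᵢ , xⱼ) = true≢false
      (true-upward x s (ℕ.<⇒≤ (ℕ.<-trans i<k k<j)) (trans (cong (λ y → lookup y i) (sym fixed)) xᵢ))
      (trans (cong (λ y → lookup y j) (sym fixed)) xⱼ)
      where
      fixed : apply C x ≡ x
      fixed = apply-sorted C x s

  -- A swap on input `x` would persist when the network's own output on `x` is fed back as input.
  -- That vector is sorted, so `C` fixes it and presents `(i , j)` with values already in order.
  redundant : ∀ x → lookup (apply C x) i Bool.≤ lookup (apply C x) j
  redundant x with lookup (apply C x) i in eqᵢ | lookup (apply C x) j in eqⱼ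
  ... | false | false = Bool.b≤b
  ... | false | true  = Bool.f≤t
  ... | true  | true  = Bool.b≤b
  ... | true  | false =
    ⊥-elim (¬swaps-sorted _ (sorting x) (swaps-apply (C ∷ʳ L) (eqᵢ , eqⱼ)))

between : {i j : Fin n} → i Fin.< j → ¬ (j IsNextAfter i) → ∃ λ k → i Fin.< k × k Fin.< j
between {i = i} {j} i<j ¬adj =
  fromℕ< i+1<n , ℕ.≤-reflexive (sym toℕ-k) , subst (_< toℕ j) (sym toℕ-k) i+1<j
  where
  i+1<j = ℕ.≤∧≢⇒< i<j (¬adj ∘ sym)
  i+1<n = ℕ.<-trans i+1<j (toℕ<n j)
  toℕ-k = toℕ-fromℕ< i+1<n

-- Layers of adjacent comparators

module _ {cs : List (Pair n)} (adj : All Adjacent cs) (ds : AllPairs Disjoint cs) where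

  private
    os : All Ordered cs
    os = All.map adjacent⇒ordered adj

    -- An adjacent comparator carries a 1 up by at most one channel.
    true-after : ∀ {x k} → lookup x k ≡ true →
      ∃ λ h → lookup (run cs x) h ≡ true × toℕ h ≤ suc (toℕ k)
    true-after {x} {k} xk with position cs k
    ... | first {j} p∈ = j , trans (run-snd ds x p∈) (cong (_∨ lookup x j) xk) ,
                         ℕ.≤-reflexive (All.lookup adj p∈)
    ... | second p∈ = k , trans (run-snd ds x p∈) (trans (cong (lookup x _ ∨_) xk) (∨-zeroʳ _)) , ℕ.n≤1+n _
    ... | absent k∉ = k , trans (run-other cs x k∉) xk , ℕ.n≤1+n _

    -- Likewise a 0 descends by at most one channel. The last component records whether it stayed or
    -- along which comparator it moved, which is how `unsorted⇒comparator` finds its comparator.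
    false-after : ∀ {x k} → lookup x k ≡ false →
      ∃ λ h → lookup (run cs x) h ≡ false × toℕ k ≤ suc (toℕ h) × (h ≡ k ⊎ (h , k) ∈ₗ cs)
    false-after {x} {k} xk with position cs k
    ... | first {j} p∈ = k , trans (run-fst os ds x p∈) (cong (_∧ lookup x j) xk) , ℕ.n≤1+n _ , inj₁ refl
    ... | second {i} p∈ = i , trans (run-fst os ds x p∈) (trans (cong (lookup x i ∧_) xk) (∧-zeroʳ _)) ,
                          ℕ.≤-reflexive (All.lookup adj p∈) , inj₂ p∈
    ... | absent k∉ = k , trans (run-other cs x k∉) xk , ℕ.n≤1+n _ , inj₁ refl

  -- The 1 from `a` leads to a 1 at some `h` no higher than `a + 1`, the 0 from `b` to a 0 at some
  -- `l` no lower than `b - 1`. Sortedness gives `l < h`, so `l ≤ a < b`: the 0 has moved, along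
  -- `(l , b)`, and `b ≤ l + 1` forces `l = a`.
  unsorted⇒comparator : ∀ x → Sorted (run cs x) → ∀ {a b} → a Fin.< b →
    lookup x a ≡ true → lookup x b ≡ false → (a , b) ∈ₗ cs
  unsorted⇒comparator x sorted {a} {b} a<b xa xb with true-after {x} xa | false-after {x} xb
  ... | h , outₕ , h≤ | l , outₗ , b≤ , l≡b∨l,b∈ = conclude l≡b∨l,b∈
    where
    l<h : l Fin.< h
    l<h = ℕ.≰⇒> λ h≤l → true≢false (true-upward (run cs x) sorted h≤l outₕ) outₗ
    l≤a : l Fin.≤ a
    l≤a = ℕ.≤-pred (ℕ.≤-trans l<h h≤)
    conclude : l ≡ b ⊎ (l , b) ∈ₗ cs → (a , b) ∈ₗ cs
    conclude (inj₁ refl) = contradiction l≤a (ℕ.<⇒≱ a<b)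
    conclude (inj₂ lb∈)  =
      subst (λ c → (c , b) ∈ₗ cs) (toℕ-injective (ℕ.≤-antisym l≤a (ℕ.≤-pred (ℕ.≤-trans a<b b≤)))) lb∈

  -- If `p` is active on `x`, then it is itself a comparator of `cs`, and `run-compareExchange`
  -- absorbs it.
  run-sorted-compareExchange : ∀ x → Sorted (run cs x) → {p : Pair n} → Ordered p →
    run cs (compareExchange x p) ≡ run cs x
  run-sorted-compareExchange x sorted {a , b} a<b with lookup x a in xa | lookup x b in xb
  ... | true  | true  = refl
  ... | false | true  = refl
  ... | false | false = refl
  ... | true  | false = trans (cong (run cs) (sym ce≡))
                          (run-compareExchange os ds (unsorted⇒comparator x sorted a<b xa xb) x)
    where
    ce≡ : compareExchange x (a , b) ≡ (x [ a ]≔ false) [ b ]≔ true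
    ce≡ rewrite xa | xb = refl

-- Saturating a layer

-- The obstruction to appending a candidate pair: a layer that meets every candidate is maximal.
Meets : Pair n → List (Pair n) → Set
Meets (a , b) cs = Any (λ c → a ∈ₚ c ⊎ b ∈ₚ c) cs

meets? : (p : Pair n) (cs : List (Pair n)) → Dec (Meets p cs)
meets? (a , b) = Any.any? λ c → (a ∈ₚ? c) ⊎-dec (b ∈ₚ? c)

¬meets⇒disjoint : {p : Pair n} {cs : List (Pair n)} → ¬ Meets p cs → All (λ c → Disjoint c p) cs
¬meets⇒disjoint ¬meets = All.map
  (λ { ¬c _ (k∈c , inj₁ refl) → ¬c (inj₁ k∈c) ; ¬c _ (k∈c , inj₂ refl) → ¬c (inj₂ k∈c) })
  (All.¬Any⇒All¬ _ ¬meets)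

module _ {R : Pred (Pair n) 0ℓ} (Q : List (Pair n) → Set)
         (extend : ∀ {cs p} → R p → All (λ c → Disjoint c p) cs → Q cs → Q (cs ∷ʳₗ p)) where

  private
    -- A single greedy pass suffices. Comparators are only appended, so a candidate once blocked
    -- stays blocked; `grow` carries this through the recursion. `Q` is the invariant preserved by
    -- each addition.
    saturateWith : ∀ {ps cs} → All R ps → Q cs →
      ∃ λ cs′ → Q cs′ × (∀ {p} → Meets p cs → Meets p cs′) × All (λ p → Meets p cs′) ps
    saturateWith {cs = cs} [] q = cs , q , (λ meets → meets) , []
    saturateWith {p ∷ ps} {cs} (r ∷ rs) q with meets? p cs
    ... | yes meets = let cs′ , q′ , grow , all = saturateWith rs q in
                      cs′ , q′ , grow , grow meets ∷ all
    ... | no ¬meets = let cs′ , q′ , grow , all = saturateWith rs (extend r (¬meets⇒disjoint ¬meets) q) in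
                      cs′ , q′ , grow ∘ Any.++⁺ˡ ,
                      grow (Any.++⁺ʳ cs (here (inj₁ (inj₁ refl)))) ∷ all

  saturate : Decidable R → ∀ {cs} → Q cs → ∃ λ cs′ → Q cs′ × (∀ {p} → R p → Meets p cs′)
  saturate R? q =
    let cs′ , q′ , _ , all = saturateWith (All.all-filter R? (cartesianProduct (allFin n) (allFin n))) q in
    cs′ , q′ , λ r → All.lookup all (∈-filter⁺ R? (∈-cartesianProduct⁺ (∈-allFin _) (∈-allFin _)) r)

disjoint-∷ʳ : {cs : List (Pair n)} {p : Pair n} → AllPairs Disjoint cs →
  All (λ c → Disjoint c p) cs → AllPairs Disjoint (cs ∷ʳₗ p)
disjoint-∷ʳ ds cs#p = AllPairs.++⁺ ds ([] ∷ []) (All.map (_∷ []) cs#p)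

saturateLast : 2 ≤ n → (C : Network n m) (L : Layer n) → IsSorting (C ∷ʳ L) →
  Σ[ L′ ∈ Layer n ] IsSorting (C ∷ʳ L′) × All Adjacent (comparators L′) ×
    (∀ {i j} → j IsNextAfter i → Meets (i , j) (comparators L′))
saturateLast {n = suc (suc n)} (s≤s (s≤s z≤n)) C L sorting with
  saturate Q extend adjacent? {filter adjacent? (comparators L)} base
  where
  adjacent? : Decidable (Adjacent {suc (suc n)})
  adjacent? (i , j) = toℕ j ≟ suc (toℕ i)

  Q : List (Pair (suc (suc n))) → Set
  Q cs = All Adjacent cs × AllPairs Disjoint cs × (∀ x → Sorted (run cs (apply C x)))

  redundant′ : ∀ x → All (λ (i , j) → ¬ Adjacent (i , j) →
                            lookup (apply C x) i Bool.≤ lookup (apply C x) j) (comparators L)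
  redundant′ x = All.tabulate λ p∈ ¬adj →
    let k , i<k , k<j = between (All.lookup (ordered L) p∈) ¬adj in
    redundant C L sorting p∈ i<k k<j x

  base : Q (filter adjacent? (comparators L))
  base = All.all-filter adjacent? (comparators L) , AllPairs.filter⁺ adjacent? (disjoint L) ,
    λ x → subst Sorted (trans (apply-∷ʳ C L x) (sym (run-filter adjacent? (disjoint L) _ (redundant′ x))))
            (sorting x)

  extend : ∀ {cs p} → Adjacent p → All (λ c → Disjoint c p) cs → Q cs → Q (cs ∷ʳₗ p)
  extend {cs} {p} a cs#p (adj , ds , sorted) = All.∷ʳ⁺ adj a , disjoint-∷ʳ ds cs#p ,
    -- Placed at the end, `p` acts on a vector that is already sorted.
    λ x → subst Sorted (sym (trans (foldl-∷ʳ compareExchange (apply C x) p cs)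
                              (compareExchange-≤ (run cs (apply C x)) (sorted x (ℕ.<⇒≤ (adjacent⇒ordered a))))))
            (sorted x)
... | cs , (adj , ds , sorted) , meets =
  L′ , (λ x → subst Sorted (sym (apply-∷ʳ C L′ x)) (sorted x)) , adj , meets
  where
  L′ : Layer (suc (suc n))
  L′ = record
    { comparators = cs
    ; nonEmpty    = λ { refl → contradiction (meets {zero , suc zero} refl) λ () }
    ; ordered     = All.map adjacent⇒ordered adj
    ; disjoint    = ds
    }

-- Sorting is part of the invariant `Q` because each new comparator is absorbed by `L` only on
-- account of `L` sorting the vectors that reach it at that stage.
saturatePenultimate : (C : Network n m) (K L : Layer n) → All Adjacent (comparators L) →
  IsSorting ((C ∷ʳ K) ∷ʳ L) →
  Σ[ K′ ∈ Layer n ] IsSorting ((C ∷ʳ K′) ∷ʳ L) ×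
    (∀ {a b} → a Fin.< b → Meets (a , b) (comparators K′))
saturatePenultimate {n = n} C K L adj sorting with
  saturate {R = Ordered} Q extend (λ (a , b) → a <ᶠ? b) {comparators K}
    (ordered K , disjoint K , nonEmpty K , λ x → subst Sorted (apply-∷ʳ² K x) (sorting x))
  where
  apply-∷ʳ² : ∀ K x → apply ((C ∷ʳ K) ∷ʳ L) x ≡ applyLayer L (applyLayer K (apply C x))
  apply-∷ʳ² K x = trans (apply-∷ʳ (C ∷ʳ K) L x) (cong (applyLayer L) (apply-∷ʳ C K x))

  Q : List (Pair n) → Set
  Q cs = All Ordered cs × AllPairs Disjoint cs × cs ≢ [] ×
         (∀ x → Sorted (applyLayer L (run cs (apply C x))))

  extend : ∀ {cs p} → Ordered p → All (λ c → Disjoint c p) cs → Q cs → Q (cs ∷ʳₗ p)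
  extend {cs} {p} o cs#p (os , ds , _ , sorted) = All.∷ʳ⁺ os o , disjoint-∷ʳ ds cs#p , nonempty cs ,
    λ x → subst Sorted (sym (trans (cong (applyLayer L) (foldl-∷ʳ compareExchange (apply C x) p cs))
                              (run-sorted-compareExchange adj (disjoint L) _ (sorted x) o)))
            (sorted x)
    where
    nonempty : ∀ cs → cs ∷ʳₗ p ≢ []
    nonempty []      ()
    nonempty (_ ∷ _) ()
... | cs , (os , ds , ne , sorted) , meets = K′ , sorting′ , meets
  where
  K′ : Layer n
  K′ = record { comparators = cs ; nonEmpty = ne ; ordered = os ; disjoint = ds }

  sorting′ : IsSorting ((C ∷ʳ K′) ∷ʳ L)
  sorting′ x = subst Sorted
    (sym (trans (apply-∷ʳ (C ∷ʳ K′) L x) (cong (applyLayer L) (apply-∷ʳ C K′ x)))) (sorted x)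

-- Co-saturation

lookup-∷ʳ-last : (xs : Vec A m) (x : A) (t : Fin (suc m)) → toℕ t ≡ m → lookup (xs ∷ʳ x) t ≡ x
lookup-∷ʳ-last []       x zero    _  = refl
lookup-∷ʳ-last (_ ∷ xs) x (suc t) eq = lookup-∷ʳ-last xs x t (ℕ.suc-injective eq)

lookup-∷ʳ-inject₁ : (xs : Vec A m) (x : A) (t : Fin m) → lookup (xs ∷ʳ x) (inject₁ t) ≡ lookup xs t
lookup-∷ʳ-inject₁ (_ ∷ _)  x zero    = refl
lookup-∷ʳ-inject₁ (_ ∷ xs) x (suc t) = lookup-∷ʳ-inject₁ xs x t

∈-at-last⁺ : (C : Network n m) (L : Layer n) {p : Pair n} → p ∈ₗ comparators L → p ∈ C ∷ʳ L at suc m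
∈-at-last⁺ {m = m} C L p∈ = fromℕ m , cong suc (toℕ-fromℕ m) ,
  subst (λ K → _ ∈ₗ comparators K) (sym (lookup-∷ʳ-last C L (fromℕ m) (toℕ-fromℕ m))) p∈

∈-at-last⁻ : (C : Network n m) (L : Layer n) {p : Pair n} → p ∈ C ∷ʳ L at suc m → p ∈ₗ comparators L
∈-at-last⁻ C L (t , eq , p∈) =
  subst (λ K → _ ∈ₗ comparators K) (lookup-∷ʳ-last C L t (ℕ.suc-injective eq)) p∈

∈-at-∷ʳ : (C : Network n m) (L : Layer n) {p : Pair n} → p ∈ C at k → p ∈ C ∷ʳ L at k
∈-at-∷ʳ C L (t , eq , p∈) = inject₁ t , trans (cong suc (toℕ-inject₁ t)) eq ,
  subst (λ K → _ ∈ₗ comparators K) (sym (lookup-∷ʳ-inject₁ C L t)) p∈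

meets⇒¬bothUnused : (C : Network n m) {K : Layer n} → (∀ {p} → p ∈ₗ comparators K → p ∈ C at k) →
  {a b : Fin n} → Meets (a , b) (comparators K) → ¬ (Unused C k a × Unused C k b)
meets⇒¬bothUnused C at meets (ua , ub) with find meets
... | c , c∈ , inj₁ a∈c = ua (c , at c∈ , a∈c)
... | c , c∈ , inj₂ b∈c = ub (c , at c∈ , b∈c)

module _ {C : Network n m} {L : Layer n} where

  private
    N : Network n (suc m)
    N = C ∷ʳ L

  pairOf : Pair n → Subset n
  pairOf (i , j) = ⁅ i ⁆ ∪ ⁅ j ⁆

  block-used : {S : Subset n} {k : Fin n} {p : Pair n} → IsBlock N S → k ∈ S →
    p ∈ₗ comparators L → k ∈ₚ p → S ≡ pairOf p
  block-used (single {i} unused) k∈ p∈ k∈p with refl ← x∈⁅y⁆⇒x≡y i k∈ =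
    ⊥-elim (unused (_ , ∈-at-last⁺ C L p∈ , k∈p))
  block-used (pair {i} {j} _ ij∈) k∈ p∈ k∈p = cong pairOf
    (comparator-unique (disjoint L) (∈-at-last⁻ C L ij∈) p∈
      (Sum.map (x∈⁅y⁆⇒x≡y i) (x∈⁅y⁆⇒x≡y j) (x∈p∪q⁻ ⁅ i ⁆ ⁅ j ⁆ k∈)) k∈p)

  block-unique : {S T : Subset n} {k : Fin n} → IsBlock N S → IsBlock N T → k ∈ S → k ∈ T → S ≡ T
  block-unique (pair {i} {j} _ ij∈) T k∈S k∈T = sym (block-used T k∈T (∈-at-last⁻ C L ij∈)
    (Sum.map (x∈⁅y⁆⇒x≡y i) (x∈⁅y⁆⇒x≡y j) (x∈p∪q⁻ ⁅ i ⁆ ⁅ j ⁆ k∈S)))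
  block-unique S (pair {i} {j} _ ij∈) k∈S k∈T = block-used S k∈S (∈-at-last⁻ C L ij∈)
    (Sum.map (x∈⁅y⁆⇒x≡y i) (x∈⁅y⁆⇒x≡y j) (x∈p∪q⁻ ⁅ i ⁆ ⁅ j ⁆ k∈T))
  block-unique (single {i} _) (single {j} _) k∈S k∈T =
    cong ⁅_⁆ (trans (sym (x∈⁅y⁆⇒x≡y i k∈S)) (x∈⁅y⁆⇒x≡y j k∈T))

  -- The last hypothesis holds vacuously when at most one channel is unused in the penultimate
  -- layer; its conclusion is what depth 1 leaves, namely n = 2 with a single comparator.
  coSaturated : All Adjacent (comparators L) →
    (∀ {i j} → j IsNextAfter i → Meets (i , j) (comparators L)) →
    (∀ {a b} → a Fin.< b → Unused N m a → Unused N m b →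
      (a , b) ∈ₗ comparators L × (∀ {p q : Fin n} → p Fin.< q → q IsNextAfter p)) →
    CoSaturated N
  coSaturated adj meets crowded = record
    { llnf = record
      { adjacent = All.lookup adj ∘ ∈-at-last⁻ C L
      ; noGap    = meets⇒¬bothUnused N {L} (∈-at-last⁺ C L) ∘ meets
      }
    ; blocks = noCrowdedBlocks
    ; flanks = λ next _ ui uj →
        let _ , allNext = crowded (adjacent⇒ordered next) ui uj in
        -- No flanking channel exists: `allNext` would make `j` the successor of both `h` and `i`,
        -- or, on the other side, `k` the successor of both `i` and `j`.
        (λ before → contradiction
          (ℕ.suc-injective (trans (sym (allNext (ℕ.<-trans (adjacent⇒ordered before) (adjacent⇒ordered next))))
                                  next))
          (ℕ.<⇒≢ (adjacent⇒ordered before))) ,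
        (λ after → contradiction
          (ℕ.suc-injective (trans (sym (allNext (ℕ.<-trans (adjacent⇒ordered next) (adjacent⇒ordered after))))
                                  after))
          (ℕ.<⇒≢ (adjacent⇒ordered next)))
    }
    where
    noCrowdedBlocks : ∀ {S T} → IsBlock N S → IsBlock N T → Consecutive S T →
      ¬ (ContainsUnused N m S × ContainsUnused N m T)
    noCrowdedBlocks S T (S≢T , _) ((a , a∈S , ua) , (b , b∈T , ub)) with <-cmp a b
    ... | tri≈ _ refl _ = S≢T (block-unique S T a∈S b∈T)
    ... | tri< a<b _ _ = let ab∈ , _ = crowded a<b ua ub in
      S≢T (trans (block-used S a∈S ab∈ (inj₁ refl)) (sym (block-used T b∈T ab∈ (inj₂ refl))))
    ... | tri> _ _ b<a = let ba∈ , _ = crowded b<a ub ua in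
      S≢T (trans (block-used S a∈S ba∈ (inj₂ refl)) (sym (block-used T b∈T ba∈ (inj₁ refl))))

-- With a single layer, every input reaches the last layer unchanged; the vector whose only 1 is on
-- `a` has an inversion with each `b` above `a`.
depth-1-comparator : (L : Layer n) → All Adjacent (comparators L) → IsSorting (L ∷ []) →
  {a b : Fin n} → a Fin.< b → (a , b) ∈ₗ comparators L
depth-1-comparator L adj sorting {a} {b} a<b =
  unsorted⇒comparator adj (disjoint L) x (sorting x) a<b
    (lookup∘update a zeros true) (trans (lookup∘update′ (<⇒≢ a<b ∘ sym) zeros true) (lookup-replicate b false))
  where
  zeros = replicate _ false
  x = zeros [ a ]≔ true

theorem4 : (n d : ℕ) → 2 ≤ n → (C : Network n d) → IsSorting C →
    Σ[ N ∈ Network n d ] (IsSorting N × CoSaturated N)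
theorem4 (suc (suc n)) zero (s≤s (s≤s z≤n)) [] sorting =
  -- Depth 0 is impossible: the empty network leaves the inversion 1, 0 in place.
  contradiction (sorting (true ∷ false ∷ replicate n false) {zero} {suc zero} z≤n) λ ()
theorem4 (suc zero) zero (s≤s ()) _ _
theorem4 n (suc d) 2≤n C sorting with initLast C
... | C₁ , L , refl with saturateLast 2≤n C₁ L sorting
theorem4 n 1 2≤n _ _ | [] , _ , refl | L , sorting , adj , meets =
  L ∷ [] , sorting ,
  coSaturated {C = []} adj meets λ a<b _ _ → only a<b , All.lookup adj ∘ only
  where
  only = depth-1-comparator L adj sorting
theorem4 n (suc (suc d)) 2≤n _ _ | C₁ , _ , refl | L , sorting , adj , meets with initLast C₁
-- The last layer comes first: absorption into `L` relies on its comparators being adjacent, and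
-- saturating the penultimate layer keeps `L` as it is.
... | C₂ , K , refl with saturatePenultimate C₂ K L adj sorting
...   | K′ , sorting′ , meets′ =
  (C₂ ∷ʳ K′) ∷ʳ L , sorting′ ,
  coSaturated adj meets λ a<b ua ub →
    ⊥-elim (meets⇒¬bothUnused ((C₂ ∷ʳ K′) ∷ʳ L) {K′} (∈-at-∷ʳ (C₂ ∷ʳ K′) L ∘ ∈-at-last⁺ C₂ K′)
              (meets′ a<b) (ua , ub))
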